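{- The Sierpinski space $\mathbb{S}$, regarded as a subset of $\Omega$, is a dominance: for every proposition $p \in \Omega$ and every $s \in \mathbb{S}$, if $s$ implies that $p \in \mathbb{S}$, then $s \land p \in \mathbb{S}$.
   Context: Foundations: constructive, predicative mathematics (sets in homotopy type theory): no excluded middle, no choice principles; function extensionality and unique choice hold. $\Omega$ denotes a set of (small) propositions, partially ordered by implication. A set $I$ is enumerable if there merely exists a surjection $\mathbb{N} \twoheadrightarrow I$ (so enumerable sets are inhabited). An $\omega$-cpo is a partial order with joins of all enumerable directed subsets; a map of $\omega$-cpos is $\omega$-continuous if it is monotone and preserves these joins. An $\omega$-cpo presentation is a preorder $P$ with a cover relation $p \triangleleft U$ ($p\in P$, $U$ an enumerable directed subset of $P$); a morphism of presentations is a monotone map $f$ with $f(p) \triangleleft f(U)$ whenever $p \triangleleft U$; an $\omega$-cpo $C$ is a presentation via $c \triangleleft U \iff c \le \bigvee U$. It is assumed that every presentation $P$ has a free $\omega$-cpo $\eta: P \to P_\omega$: $\eta$ is a morphism of presentations into an $\omega$-cpo such that every morphism $f : P \to C$ into an $\omega$-cpo factors uniquely as $f = \bar f \eta$ with $\bar f$ $\omega$-continuous. The Sierpinski space is $\mathbb{S} = \mathbb{B}_\omega$, the free $\omega$-cpo over the two-element partial order $\mathbb{B} = \{\bot \le \top\}$ (with no covers). It is a $\sigma$-frame, and the map $\mathbb{S} \to \Omega$, $s \mapsto (s = \top)$, embeds $\mathbb{S}$ as a suborder of $\Omega$ preserving $\bot,\top$, binary meets and enumerable joins; elements of $\mathbb{S}$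 are identified with their image propositions, and for $p\in\Omega$, "$p \in \mathbb{S}$" means $p$ lies in the image. -}

module Defs where

-- The ambient principles of the paper's
-- foundations that are not available in --safe Agda (function
-- extensionality, propositional extensionality, propositional truncation)
-- are packaged in the record `Foundations` and taken as a hypothesis.

open import Level using (Level; _⊔_; Setω) renaming (zero to 0ℓ; suc to lsuc)
open import Data.Nat using (ℕ)
open import Data.Product using (Σ; _×_; _,_; proj₁; proj₂)
open import Relation.Binary.PropositionalEquality using (_≡_)

private variable
  a b c ℓ : Level

isProp : Set a → Set a
isProp A = (x y : A) → x ≡ y

isSet : Set a → Set a
isSet A = (x y : A) → isProp (x ≡ y)

record Foundations : Setω where
  field
    funext   : {A : Set a} {B : A → Set b} {f g : (x : A) → B x}
             → ((x : A) → f x ≡ g x) → f ≡ g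
    propext  : {P Q : Set a} → isProp P → isProp Q
             → (P → Q) → (Q → P) → P ≡ Q
    ∥_∥      : Set a → Set a
    ∣_∣      : {A : Set a} → A → ∥ A ∥
    ∥∥-isProp : {A : Set a} → isProp ∥ A ∥
    ∥∥-rec   : {A : Set a} {B : Set b} → isProp B → (A → B) → ∥ A ∥ → B

Ω : Set₁
Ω = Σ Set isProp

data 𝔹 : Set where
  ⊥𝔹 ⊤𝔹 : 𝔹

data _≤𝔹_ : 𝔹 → 𝔹 → Set where
  ⊥≤ : {x : 𝔹} → ⊥𝔹 ≤𝔹 x
  ⊤≤⊤ : ⊤𝔹 ≤𝔹 ⊤𝔹

module WithFoundations (F : Foundations) where
  open Foundations F public

  Subset : Set a → Set (a ⊔ lsuc 0ℓ)
  Subset A = A → Ω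

  _∈_ : {A : Set a} → A → Subset A → Set
  x ∈ U = proj₁ (U x)

  Elem : {A : Set a} → Subset A → Set a
  Elem {A = A} U = Σ A (λ x → x ∈ U)

  Surjective : {A : Set a} {B : Set b} → (A → B) → Set (a ⊔ b)
  Surjective {A = A} {B = B} f = (y : B) → ∥ Σ A (λ x → f x ≡ y) ∥

  Enumerable : {A : Set a} → Subset A → Set a
  Enumerable U = ∥ Σ (ℕ → Elem U) Surjective ∥

  record OmegaCPO (c ℓ : Level) : Set (lsuc (c ⊔ ℓ)) where
    field
      Carrier   : Set c
      _≤_       : Carrier → Carrier → Set ℓ
      carrier-isSet : isSet Carrier
      ≤-isProp  : (x y : Carrier) → isProp (x ≤ y)
      ≤-refl    : (x : Carrier) → x ≤ x
      ≤-trans   : {x y z : Carrier} → x ≤ y → y ≤ z → x ≤ z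
      ≤-antisym : {x y : Carrier} → x ≤ y → y ≤ x → x ≡ y

    Directed : Subset Carrier → Set (c ⊔ ℓ)
    Directed U = ∥ Elem U ∥
               × ((x y : Carrier) → x ∈ U → y ∈ U
                   → ∥ Σ Carrier (λ z → z ∈ U × x ≤ z × y ≤ z) ∥)

    IsUpperBound : Subset Carrier → Carrier → Set (c ⊔ ℓ)
    IsUpperBound U j = (x : Carrier) → x ∈ U → x ≤ j

    IsJoin : Subset Carrier → Carrier → Set (c ⊔ ℓ)
    IsJoin U j = IsUpperBound U j
               × ((u : Carrier) → IsUpperBound U u → j ≤ u)

    field
      ⋁      : (U : Subset Carrier) → Enumerable U → Directed U → Carrier
      ⋁-join : (U : Subset Carrier) (e : Enumerable U) (d : Directed U)
             → IsJoin U (⋁ U e d)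

  open OmegaCPO

  -- ω-continuous maps: monotone, and f (⋁ U) is the join of f[U]
  -- (the join of the image {f x | x ∈ U}, written out directly).
  record IsOmegaContinuous {c ℓ c' ℓ' : Level}
         (C : OmegaCPO c ℓ) (D : OmegaCPO c' ℓ')
         (f : Carrier C → Carrier D) : Set (lsuc 0ℓ ⊔ c ⊔ ℓ ⊔ c' ⊔ ℓ') where
    field
      monotone : {x y : Carrier C} → _≤_ C x y → _≤_ D (f x) (f y)
      preserves-⋁ : (U : Subset (Carrier C)) (e : Enumerable U) (d : Directed C U)
        → ((x : Carrier C) → x ∈ U → _≤_ D (f x) (f (⋁ C U e d)))
        × ((u : Carrier D) → ((x : Carrier C) → x ∈ U → _≤_ D (f x) u)
             → _≤_ D (f (⋁ C U e d)) u)

  -- η : 𝔹 → S exhibits S as the free ω-cpo over the presentation 𝔹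
  -- (no covers, so morphisms of presentations 𝔹 → C are monotone maps).
  record IsFreeOver𝔹 (S : OmegaCPO 0ℓ 0ℓ) (η : 𝔹 → Carrier S) : Setω where
    field
      η-monotone : {x y : 𝔹} → x ≤𝔹 y → _≤_ S (η x) (η y)
      extend : {c ℓ : Level} (C : OmegaCPO c ℓ) (f : 𝔹 → Carrier C)
             → ({x y : 𝔹} → x ≤𝔹 y → _≤_ C (f x) (f y))
             → Σ (Carrier S → Carrier C)
                 (λ f̄ → IsOmegaContinuous S C f̄ × ((x : 𝔹) → f̄ (η x) ≡ f x))
      unique : {c ℓ : Level} (C : OmegaCPO c ℓ) (f : 𝔹 → Carrier C)
             → (g h : Carrier S → Carrier C)
             → IsOmegaContinuous S C g → ((x : 𝔹) → g (η x) ≡ f x)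
             → IsOmegaContinuous S C h → ((x : 𝔹) → h (η x) ≡ f x)
             → (s : Carrier S) → g s ≡ h s

  module Sierpinski (S : OmegaCPO 0ℓ 0ℓ) (η : 𝔹 → Carrier S) where
    toΩ : Carrier S → Ω
    toΩ s = (s ≡ η ⊤𝔹) , carrier-isSet S s (η ⊤𝔹)

    In𝕊 : Ω → Set₁
    In𝕊 p = ∥ Σ (Carrier S) (λ t → toΩ t ≡ p) ∥

    _∧Ω_ : Ω → Ω → Ω
    (P , pP) ∧Ω (Q , pQ) = (P × Q) , λ { (x , y) (x' , y') → ×-eq (pP x x') (pQ y y') }
      where
        open import Relation.Binary.PropositionalEquality using (cong₂)
        ×-eq : {A B : Set} {x x' : A} {y y' : B} → x ≡ x' → y ≡ y' → (x , y) ≡ (x' , y')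
        ×-eq = cong₂ _,_

{-# OPTIONS --safe #-}
module Submission where

-- 𝕊 satisfies an induction principle: a property closed under ⊥, ⊤ and
-- directed joins holds everywhere, because the ω-cpo of elements with the
-- property receives a map from the free ω-cpo that must be a section of the
-- inclusion. Using it, s ↦ (s = ⊤) is an order embedding preserving joins
-- (⊤ is compact), so "t classifies P" has at most one witness t. The dominance
-- property is then proved by induction on s: at a join ⋁ U, unique choice
-- gives for each x ∈ U the classifier of x = ⊤ ∧ p, and these form a directed
-- family whose join classifies ⋁ U = ⊤ ∧ p.

open import Defs
open import Axiom.UniquenessOfIdentityProofs.WithK using (uip)
open import Data.Empty using (⊥; ⊥-elim)
open import Data.Nat using (ℕ)
open import Data.Product using (Σ; _×_; _,_; proj₁; proj₂)
open import Data.Unit using (⊤; tt)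
open import Function using (id; _∘_)
open import Level using (Level; _⊔_; 0ℓ)
open import Relation.Nullary using (¬_)
open import Relation.Binary.PropositionalEquality using (_≡_; _≢_; refl; sym; trans; cong; cong₂; subst)

private variable
  a b c ℓ ℓ' ℓ'' : Level

isSet-K : {A : Set a} → isSet A
isSet-K _ _ = uip

isProp-× : {A : Set a} {B : Set b} → isProp A → isProp B → isProp (A × B)
isProp-× A-prop B-prop (x , y) (x' , y') = cong₂ _,_ (A-prop x x') (B-prop y y')

Σ-≡-prop : {A : Set a} {B : A → Set b} → ((x : A) → isProp (B x))
         → {u v : Σ A B} → proj₁ u ≡ proj₁ v → u ≡ v
Σ-≡-prop B-prop {x , _} {.x , _} refl = cong (x ,_) (B-prop x _ _)

module _ (F : Foundations) where
  open WithFoundations F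
  open OmegaCPO using (Carrier; Directed; ⋁)

  isProp-Π : {A : Set a} {B : A → Set b} → ((x : A) → isProp (B x))
           → isProp ((x : A) → B x)
  isProp-Π B-prop f g = funext (λ x → B-prop x (f x) (g x))

  isProp-isProp : {A : Set a} → isProp (isProp A)
  isProp-isProp f g = funext (λ x → funext (λ y → isSet-K x y (f x y) (g x y)))

  Ω-≡ : {P Q : Ω} → (proj₁ P → proj₁ Q) → (proj₁ Q → proj₁ P) → P ≡ Q
  Ω-≡ {P} {Q} f g = Σ-≡-prop (λ _ → isProp-isProp) (propext (proj₂ P) (proj₂ Q) f g)

  ∥∥-map : {A : Set a} {B : Set b} → (A → B) → ∥ A ∥ → ∥ B ∥
  ∥∥-map f = ∥∥-rec ∥∥-isProp (∣_∣ ∘ f)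

  module _ {A : Set a} {B : Set b} (B-set : isSet B) (f : A → B)
           (f-constant : (x y : A) → f x ≡ f y) where
    private
      Range : Set (a ⊔ b)
      Range = Σ B (λ y → ∥ Σ A (λ x → f x ≡ y) ∥)

      isProp-Range : isProp Range
      isProp-Range (y , y∈) (y' , y'∈) = Σ-≡-prop (λ _ → ∥∥-isProp)
        (∥∥-rec (B-set y y') (λ (x , fx≡y) → ∥∥-rec (B-set y y')
          (λ (x' , fx'≡y') → trans (sym fx≡y) (trans (f-constant x x') fx'≡y')) y'∈) y∈)

      range-point : ∥ A ∥ → Range
      range-point = ∥∥-rec isProp-Range (λ x → f x , ∣ x , refl ∣)

    rec-constant : ∥ A ∥ → B
    rec-constant = proj₁ ∘ range-point

    rec-constant-elim : (Q : B → Set ℓ) → ((y : B) → isProp (Q y))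
                      → ((x : A) → Q (f x)) → (t : ∥ A ∥) → Q (rec-constant t)
    rec-constant-elim Q Q-prop Q-f t = ∥∥-rec (Q-prop _)
      (λ (x , fx≡y) → subst Q fx≡y (Q-f x)) (proj₂ (range-point t))

  -- The join is "∃ n. en n holds" for any enumeration en of U (the choice of en
  -- does not matter): quantifying over ℕ rather than over U keeps it small.
  module _ (U : Subset Ω) where
    private
      Enumeration : Set₁
      Enumeration = Σ (ℕ → Elem U) Surjective

      someHolds : Enumeration → Ω
      someHolds (en , _) = ∥ Σ ℕ (λ n → proj₁ (proj₁ (en n))) ∥ , ∥∥-isProp

      someHolds-intro : (en : Enumeration) (P : Ω) → P ∈ U → proj₁ P → proj₁ (someHolds en)
      someHolds-intro (en , en-surj) P P∈U p = ∥∥-map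
        (λ (n , en≡P) → n , subst (proj₁ ∘ proj₁) (sym en≡P) p) (en-surj (P , P∈U))

      someHolds-elim : (en : Enumeration) {Z : Set ℓ} → isProp Z
                     → ((P : Ω) → P ∈ U → proj₁ P → Z) → proj₁ (someHolds en) → Z
      someHolds-elim (en , _) Z-prop h = ∥∥-rec Z-prop
        (λ (n , p) → h (proj₁ (en n)) (proj₂ (en n)) p)

    ⋁Ω : Enumerable U → Ω
    ⋁Ω = rec-constant isSet-K someHolds (λ en en' → Ω-≡
      (someHolds-elim en ∥∥-isProp (someHolds-intro en'))
      (someHolds-elim en' ∥∥-isProp (someHolds-intro en)))

    ⋁Ω-upper : (e : Enumerable U) (P : Ω) → P ∈ U → proj₁ P → proj₁ (⋁Ω e)
    ⋁Ω-upper e P P∈U p = rec-constant-elim isSet-K someHolds _ proj₁ proj₂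
      (λ en → someHolds-intro en P P∈U p) e

    ⋁Ω-least : (e : Enumerable U) (Q : Ω) → ((P : Ω) → P ∈ U → proj₁ P → proj₁ Q)
             → proj₁ (⋁Ω e) → proj₁ Q
    ⋁Ω-least e Q h = rec-constant-elim isSet-K someHolds _ (λ R → proj₁ R → proj₁ Q)
      (λ _ → isProp-Π (λ _ → proj₂ Q)) (λ en → someHolds-elim en (proj₂ Q) h) e

  Ω-ωcpo : OmegaCPO (Level.suc 0ℓ) 0ℓ
  Ω-ωcpo .Carrier = Ω
  Ω-ωcpo .OmegaCPO._≤_ P Q = proj₁ P → proj₁ Q
  Ω-ωcpo .OmegaCPO.carrier-isSet = isSet-K
  Ω-ωcpo .OmegaCPO.≤-isProp P Q = isProp-Π (λ _ → proj₂ Q)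
  Ω-ωcpo .OmegaCPO.≤-refl _ = id
  Ω-ωcpo .OmegaCPO.≤-trans f g = g ∘ f
  Ω-ωcpo .OmegaCPO.≤-antisym = Ω-≡
  Ω-ωcpo .⋁ U e _ = ⋁Ω U e
  Ω-ωcpo .OmegaCPO.⋁-join U e _ = ⋁Ω-upper U e , ⋁Ω-least U e

  image : {A B : Set} (U : Subset A) → (Elem U → B) → Subset B
  image U f y = ∥ Σ (Elem U) (λ x → f x ≡ y) ∥ , ∥∥-isProp

  image-enumerable : {A B : Set} (U : Subset A) (f : Elem U → B)
                   → Enumerable U → Enumerable (image U f)
  image-enumerable U f = ∥∥-map λ (en , en-surj) →
    (λ n → f (en n) , ∣ en n , refl ∣) ,
    λ (y , y∈) → ∥∥-rec ∥∥-isProp (λ (x , fx≡y) → ∥∥-map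
      (λ (n , en≡x) → n , Σ-≡-prop (λ _ → ∥∥-isProp) (trans (cong f en≡x) fx≡y))
      (en-surj x)) y∈

  IsDirected : {A : Set} → (A → A → Set ℓ) → Subset A → Set ℓ
  IsDirected {A = A} _≤_ U =
    ∥ Elem U ∥ × ((x y : A) → x ∈ U → y ∈ U → ∥ Σ A (λ z → z ∈ U × x ≤ z × y ≤ z) ∥)

  image-directed : {A B : Set} (_≤_ : A → A → Set ℓ) (_⊑_ : B → B → Set ℓ') (U : Subset A)
    (f : Elem U → B) → ((x y : Elem U) → proj₁ x ≤ proj₁ y → f x ⊑ f y)
    → IsDirected _≤_ U → IsDirected _⊑_ (image U f)
  image-directed _ _⊑_ U f f-monotone (inhabited , upper) =
    ∥∥-map (λ x → f x , ∣ x , refl ∣) inhabited ,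
    λ y₁ y₂ y₁∈ y₂∈ → ∥∥-rec ∥∥-isProp (λ (x₁ , fx₁≡y₁) → ∥∥-rec ∥∥-isProp (λ (x₂ , fx₂≡y₂) →
      ∥∥-map (λ (z , z∈U , x₁≤z , x₂≤z) →
        f (z , z∈U) , ∣ (z , z∈U) , refl ∣ ,
        subst (_⊑ f (z , z∈U)) fx₁≡y₁ (f-monotone x₁ (z , z∈U) x₁≤z) ,
        subst (_⊑ f (z , z∈U)) fx₂≡y₂ (f-monotone x₂ (z , z∈U) x₂≤z))
      (upper (proj₁ x₁) (proj₁ x₂) (proj₂ x₁) (proj₂ x₂))) y₂∈) y₁∈

  id-continuous : (C : OmegaCPO c ℓ) → IsOmegaContinuous C C id
  id-continuous C .IsOmegaContinuous.monotone = id
  id-continuous C .IsOmegaContinuous.preserves-⋁ = OmegaCPO.⋁-join C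

  ∘-continuous : {C : OmegaCPO 0ℓ ℓ} {D : OmegaCPO 0ℓ ℓ'} {E : OmegaCPO c ℓ''}
    {g : Carrier D → Carrier E} {f : Carrier C → Carrier D}
    → IsOmegaContinuous D E g → IsOmegaContinuous C D f → IsOmegaContinuous C E (g ∘ f)
  ∘-continuous {C = C} {D} {E} {g} {f} g-cont f-cont = record
    { monotone = g.monotone ∘ f.monotone
    ; preserves-⋁ = λ U e d →
        (λ x x∈U → g.monotone (proj₁ (f.preserves-⋁ U e d) x x∈U)) ,
        (λ u u-upper → E.≤-trans (g.monotone (f⋁≤⋁f U e d))
          (proj₂ (g.preserves-⋁ (V U) (V-enumerable U e) (V-directed U d)) u
            (λ y y∈V → ∥∥-rec (E.≤-isProp _ _)
              (λ ((x , x∈U) , fx≡y) → subst (λ y → g y E.≤ u) fx≡y (u-upper x x∈U)) y∈V)))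
    }
    where
      module C = OmegaCPO C
      module D = OmegaCPO D
      module E = OmegaCPO E
      module f = IsOmegaContinuous f-cont
      module g = IsOmegaContinuous g-cont

      V : Subset C.Carrier → Subset D.Carrier
      V U = image U (f ∘ proj₁)

      V-enumerable : (U : Subset C.Carrier) → Enumerable U → Enumerable (V U)
      V-enumerable U = image-enumerable U (f ∘ proj₁)

      V-directed : (U : Subset C.Carrier) → Directed C U → Directed D (V U)
      V-directed U = image-directed C._≤_ D._≤_ U (f ∘ proj₁) (λ _ _ → f.monotone)

      f⋁≤⋁f : (U : Subset C.Carrier) (e : Enumerable U) (d : Directed C U)
            → f (C.⋁ U e d) D.≤ D.⋁ (V U) (V-enumerable U e) (V-directed U d)
      f⋁≤⋁f U e d = proj₂ (f.preserves-⋁ U e d) _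
        (λ x x∈U → proj₁ (D.⋁-join (V U) (V-enumerable U e) (V-directed U d)) (f x) ∣ (x , x∈U) , refl ∣)

  module _ (C : OmegaCPO 0ℓ ℓ) (Q : Carrier C → Set) (Q-prop : (x : Carrier C) → isProp (Q x))
           (Q-⋁ : (U : Subset (Carrier C)) (e : Enumerable U) (d : Directed C U)
                → ((x : Carrier C) → x ∈ U → Q x) → Q (⋁ C U e d)) where
    private
      module C = OmegaCPO C

      _≤Σ_ : Σ C.Carrier Q → Σ C.Carrier Q → Set ℓ
      x ≤Σ y = proj₁ x C.≤ proj₁ y

      V : Subset (Σ C.Carrier Q) → Subset C.Carrier
      V W = image W (proj₁ ∘ proj₁)

      V-enumerable : (W : Subset (Σ C.Carrier Q)) → Enumerable W → Enumerable (V W)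
      V-enumerable W = image-enumerable W (proj₁ ∘ proj₁)

      V-directed : (W : Subset (Σ C.Carrier Q)) → IsDirected _≤Σ_ W → Directed C (V W)
      V-directed W = image-directed _≤Σ_ C._≤_ W (proj₁ ∘ proj₁) (λ _ _ → id)

      ⋁V : (W : Subset (Σ C.Carrier Q)) → Enumerable W → IsDirected _≤Σ_ W → C.Carrier
      ⋁V W e d = C.⋁ (V W) (V-enumerable W e) (V-directed W d)

      ⋁V-upper : (W : Subset (Σ C.Carrier Q)) (e : Enumerable W) (d : IsDirected _≤Σ_ W)
               → (x : Σ C.Carrier Q) → x ∈ W → proj₁ x C.≤ ⋁V W e d
      ⋁V-upper W e d x x∈W =
        proj₁ (C.⋁-join (V W) (V-enumerable W e) (V-directed W d)) (proj₁ x) ∣ (x , x∈W) , refl ∣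

      ⋁V-least : (W : Subset (Σ C.Carrier Q)) (e : Enumerable W) (d : IsDirected _≤Σ_ W)
               → (u : C.Carrier) → ((x : Σ C.Carrier Q) → x ∈ W → proj₁ x C.≤ u) → ⋁V W e d C.≤ u
      ⋁V-least W e d u u-upper = proj₂ (C.⋁-join (V W) (V-enumerable W e) (V-directed W d)) u
        (λ y → ∥∥-rec (C.≤-isProp _ _) (λ ((x , x∈W) , x≡y) → subst (C._≤ u) x≡y (u-upper x x∈W)))

    Σ-ωcpo : OmegaCPO 0ℓ ℓ
    Σ-ωcpo .Carrier = Σ C.Carrier Q
    Σ-ωcpo .OmegaCPO._≤_ = _≤Σ_
    Σ-ωcpo .OmegaCPO.carrier-isSet = isSet-K
    Σ-ωcpo .OmegaCPO.≤-isProp _ _ = C.≤-isProp _ _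
    Σ-ωcpo .OmegaCPO.≤-refl _ = C.≤-refl _
    Σ-ωcpo .OmegaCPO.≤-trans = C.≤-trans
    Σ-ωcpo .OmegaCPO.≤-antisym x≤y y≤x = Σ-≡-prop Q-prop (C.≤-antisym x≤y y≤x)
    Σ-ωcpo .⋁ W e d = ⋁V W e d ,
      Q-⋁ (V W) (V-enumerable W e) (V-directed W d) (λ y → ∥∥-rec (Q-prop y)
        (λ ((x , _) , x≡y) → subst Q x≡y (proj₂ x)))
    Σ-ωcpo .OmegaCPO.⋁-join W e d = ⋁V-upper W e d , λ u → ⋁V-least W e d (proj₁ u)

    proj₁-continuous : IsOmegaContinuous Σ-ωcpo C proj₁
    proj₁-continuous .IsOmegaContinuous.monotone = id
    proj₁-continuous .IsOmegaContinuous.preserves-⋁ W e d = ⋁V-upper W e d , ⋁V-least W e d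

  module FreeSierpinski (S : OmegaCPO 0ℓ 0ℓ) (η : 𝔹 → Carrier S) (free : IsFreeOver𝔹 S η) where
    open Sierpinski S η
    open IsFreeOver𝔹 free
    open OmegaCPO S using (_≤_; ≤-isProp; ≤-refl; ≤-trans; ≤-antisym; ⋁-join)
      renaming (Carrier to |S|; ⋁ to ⋁S)

    ⊥S ⊤S : |S|
    ⊥S = η ⊥𝔹
    ⊤S = η ⊤𝔹

    ⋁S-upper : (U : Subset |S|) (e : Enumerable U) (d : Directed S U)
             → (x : |S|) → x ∈ U → x ≤ ⋁S U e d
    ⋁S-upper U e d = proj₁ (⋁-join U e d)

    ⋁S-least : (U : Subset |S|) (e : Enumerable U) (d : Directed S U)
             → (u : |S|) → ((x : |S|) → x ∈ U → x ≤ u) → ⋁S U e d ≤ u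
    ⋁S-least U e d = proj₂ (⋁-join U e d)

    S-ind : (Q : |S| → Set) → ((s : |S|) → isProp (Q s)) → Q ⊥S → Q ⊤S
          → ((U : Subset |S|) (e : Enumerable U) (d : Directed S U)
             → ((x : |S|) → x ∈ U → Q x) → Q (⋁S U e d))
          → (s : |S|) → Q s
    S-ind Q Q-prop Q⊥ Q⊤ Q-⋁ s = subst Q (proj₁∘lift≡id s) (proj₂ (lift s))
      where
        Q-η : (x : 𝔹) → Q (η x)
        Q-η ⊥𝔹 = Q⊥
        Q-η ⊤𝔹 = Q⊤

        T : OmegaCPO 0ℓ 0ℓ
        T = Σ-ωcpo S Q Q-prop Q-⋁

        lift-extension : Σ (|S| → Σ |S| Q)
          (λ lift → IsOmegaContinuous S T lift × ((x : 𝔹) → lift (η x) ≡ (η x , Q-η x)))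
        lift-extension = extend T (λ x → η x , Q-η x) η-monotone

        lift : |S| → Σ |S| Q
        lift = proj₁ lift-extension

        proj₁∘lift≡id : (s : |S|) → proj₁ (lift s) ≡ s
        proj₁∘lift≡id = unique S η (proj₁ ∘ lift) id
          (∘-continuous (proj₁-continuous S Q Q-prop Q-⋁) (proj₁ (proj₂ lift-extension)))
          (λ x → cong proj₁ (proj₂ (proj₂ lift-extension) x))
          (id-continuous S) (λ _ → refl)

    ⊥S-least : (s : |S|) → ⊥S ≤ s
    ⊥S-least = S-ind _ (λ _ → ≤-isProp _ _) (≤-refl _) (η-monotone ⊥≤)
      (λ U e d ⊥≤U → ∥∥-rec (≤-isProp _ _)
        (λ (x , x∈U) → ≤-trans (⊥≤U x x∈U) (⋁S-upper U e d x x∈U)) (proj₁ d))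

    ⊤S-greatest : (s : |S|) → s ≤ ⊤S
    ⊤S-greatest = S-ind _ (λ _ → ≤-isProp _ _) (η-monotone ⊥≤) (≤-refl _)
      (λ U e d → ⋁S-least U e d ⊤S)

    ⊤-upward-closed : {s t : |S|} → s ≤ t → s ≡ ⊤S → t ≡ ⊤S
    ⊤-upward-closed {t = t} s≤t refl = ≤-antisym (⊤S-greatest t) s≤t

    private
      χ𝔹 : 𝔹 → Ω
      χ𝔹 ⊥𝔹 = ⊥ , λ ()
      χ𝔹 ⊤𝔹 = ⊤ , λ _ _ → refl

      χ𝔹-monotone : {x y : 𝔹} → x ≤𝔹 y → proj₁ (χ𝔹 x) → proj₁ (χ𝔹 y)
      χ𝔹-monotone ⊥≤ ()
      χ𝔹-monotone ⊤≤⊤ = id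

      χ-extension : Σ (|S| → Ω)
        (λ χ → IsOmegaContinuous S Ω-ωcpo χ × ((x : 𝔹) → χ (η x) ≡ χ𝔹 x))
      χ-extension = extend Ω-ωcpo χ𝔹 χ𝔹-monotone

    -- χ s holds iff s = ⊤ (χ⇒≡⊤), so the ω-continuity of χ makes ⊤ compact.
    χ : |S| → Ω
    χ = proj₁ χ-extension

    χ⊤ : proj₁ (χ ⊤S)
    χ⊤ = subst proj₁ (sym (proj₂ (proj₂ χ-extension) ⊤𝔹)) tt

    ¬χ⊥ : ¬ proj₁ (χ ⊥S)
    ¬χ⊥ = subst proj₁ (proj₂ (proj₂ χ-extension) ⊥𝔹)

    χ-⋁ : (U : Subset |S|) (e : Enumerable U) (d : Directed S U)
        → proj₁ (χ (⋁S U e d)) → ∥ Σ (Elem U) (λ x → proj₁ (χ (proj₁ x))) ∥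
    χ-⋁ U e d = proj₂ (IsOmegaContinuous.preserves-⋁ (proj₁ (proj₂ χ-extension)) U e d)
      (∥ Σ (Elem U) (λ x → proj₁ (χ (proj₁ x))) ∥ , ∥∥-isProp)
      (λ x x∈U χx → ∣ (x , x∈U) , χx ∣)

    χ⇒≡⊤ : (s : |S|) → proj₁ (χ s) → s ≡ ⊤S
    χ⇒≡⊤ = S-ind _ (λ _ → isProp-Π (λ _ → isSet-K _ _)) (⊥-elim ∘ ¬χ⊥) (λ _ → refl)
      (λ U e d IH χ⋁ → ∥∥-rec (isSet-K _ _)
        (λ ((x , x∈U) , χx) → ⊤-upward-closed (⋁S-upper U e d x x∈U) (IH x x∈U χx))
        (χ-⋁ U e d χ⋁))

    ⊥S≢⊤S : ⊥S ≢ ⊤S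
    ⊥S≢⊤S ⊥≡⊤ = ¬χ⊥ (subst (proj₁ ∘ χ) (sym ⊥≡⊤) χ⊤)

    ⊤-compact : (U : Subset |S|) (e : Enumerable U) (d : Directed S U)
              → ⋁S U e d ≡ ⊤S → ∥ Σ (Elem U) (λ x → proj₁ x ≡ ⊤S) ∥
    ⊤-compact U e d ⋁≡⊤ = ∥∥-map (λ (x , χx) → x , χ⇒≡⊤ (proj₁ x) χx)
      (χ-⋁ U e d (subst (proj₁ ∘ χ) (sym ⋁≡⊤) χ⊤))

    ≤-from-⊤-implication : (s t : |S|) → (s ≡ ⊤S → t ≡ ⊤S) → s ≤ t
    ≤-from-⊤-implication = S-ind _ (λ _ → isProp-Π (λ _ → isProp-Π (λ _ → ≤-isProp _ _)))
      (λ t _ → ⊥S-least t)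
      (λ t ⊤≡⊤→t≡⊤ → subst (⊤S ≤_) (sym (⊤≡⊤→t≡⊤ refl)) (≤-refl _))
      (λ U e d IH t ⋁≡⊤→t≡⊤ → ⋁S-least U e d t (λ x x∈U →
        IH x x∈U t (⋁≡⊤→t≡⊤ ∘ ⊤-upward-closed (⋁S-upper U e d x x∈U))))

    ≡-from-⊤-iff : (s t : |S|) → (s ≡ ⊤S → t ≡ ⊤S) → (t ≡ ⊤S → s ≡ ⊤S) → s ≡ t
    ≡-from-⊤-iff s t s→t t→s =
      ≤-antisym (≤-from-⊤-implication s t s→t) (≤-from-⊤-implication t s t→s)

    _classifies_ : |S| → Set → Set
    t classifies P = (t ≡ ⊤S → P) × (P → t ≡ ⊤S)

    Classifier : Set → Set
    Classifier P = Σ |S| (_classifies P)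

    isProp-Classifier : {P : Set} → isProp P → isProp (Classifier P)
    isProp-Classifier P-prop (t , t→P , P→t) (t' , t'→P , P→t') =
      Σ-≡-prop (λ _ → isProp-× (isProp-Π (λ _ → P-prop)) (isProp-Π (λ _ → isSet-K _ _)))
        (≡-from-⊤-iff t t' (P→t' ∘ t→P) (P→t ∘ t'→P))

    In𝕊⇒Classifier : (p : Ω) → In𝕊 p → Classifier (proj₁ p)
    In𝕊⇒Classifier p = ∥∥-rec (isProp-Classifier (proj₂ p))
      (λ (t , t≡p) → t , subst proj₁ t≡p , subst proj₁ (sym t≡p))

    Classifier⇒In𝕊 : (p : Ω) → Classifier (proj₁ p) → In𝕊 p
    Classifier⇒In𝕊 p (t , t→p , p→t) = ∣ t , Ω-≡ t→p p→t ∣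

    module _ {P : Set} (P-prop : isProp P) where
      ⋁-Classifier-∧ : (U : Subset |S|) (e : Enumerable U) (d : Directed S U)
        → ((x : Elem U) → Classifier ((proj₁ x ≡ ⊤S) × P))
        → Classifier ((⋁S U e d ≡ ⊤S) × P)
      ⋁-Classifier-∧ U e d c = ⋁c , ⋁c→ , →⋁c
        where
          c-monotone : (x y : Elem U) → proj₁ x ≤ proj₁ y → proj₁ (c x) ≤ proj₁ (c y)
          c-monotone x y x≤y = ≤-from-⊤-implication (proj₁ (c x)) (proj₁ (c y)) λ cx≡⊤ →
            let (x≡⊤ , p) = proj₁ (proj₂ (c x)) cx≡⊤
            in proj₂ (proj₂ (c y)) (⊤-upward-closed x≤y x≡⊤ , p)

          V : Subset |S|
          V = image U (proj₁ ∘ c)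

          V-enumerable : Enumerable V
          V-enumerable = image-enumerable U (proj₁ ∘ c) e

          V-directed : Directed S V
          V-directed = image-directed _≤_ _≤_ U (proj₁ ∘ c) c-monotone d

          ⋁c : |S|
          ⋁c = ⋁S V V-enumerable V-directed

          ⋁c→ : ⋁c ≡ ⊤S → (⋁S U e d ≡ ⊤S) × P
          ⋁c→ ⋁c≡⊤ = ∥∥-rec (isProp-× (isSet-K _ _) P-prop)
            (λ ((y , y∈V) , y≡⊤) → ∥∥-rec (isProp-× (isSet-K _ _) P-prop)
              (λ ((x , x∈U) , cx≡y) →
                let (x≡⊤ , p) = proj₁ (proj₂ (c (x , x∈U))) (trans cx≡y y≡⊤)
                in ⊤-upward-closed (⋁S-upper U e d x x∈U) x≡⊤ , p)
              y∈V)
            (⊤-compact V V-enumerable V-directed ⋁c≡⊤)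

          →⋁c : (⋁S U e d ≡ ⊤S) × P → ⋁c ≡ ⊤S
          →⋁c (⋁≡⊤ , p) = ∥∥-rec (isSet-K _ _)
            (λ (x , x≡⊤) → ⊤-upward-closed
              (⋁S-upper V V-enumerable V-directed (proj₁ (c x)) ∣ x , refl ∣)
              (proj₂ (proj₂ (c x)) (x≡⊤ , p)))
            (⊤-compact U e d ⋁≡⊤)

      ∧-Classifier : (s : |S|) → (s ≡ ⊤S → Classifier P) → Classifier ((s ≡ ⊤S) × P)
      ∧-Classifier = S-ind _
        (λ _ → isProp-Π (λ _ → isProp-Classifier (isProp-× (isSet-K _ _) P-prop)))
        (λ _ → ⊥S , ⊥-elim ∘ ⊥S≢⊤S , proj₁)
        (λ classify-P → let (t , t→P , P→t) = classify-P refl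
                        in t , (λ t≡⊤ → refl , t→P t≡⊤) , P→t ∘ proj₂)
        (λ U e d IH classify-P → ⋁-Classifier-∧ U e d (λ (x , x∈U) →
          IH x x∈U (classify-P ∘ ⊤-upward-closed (⋁S-upper U e d x x∈U))))

    dominance : (p : Ω) (s : |S|) → (proj₁ (toΩ s) → In𝕊 p) → In𝕊 (toΩ s ∧Ω p)
    dominance p s s→p∈𝕊 = Classifier⇒In𝕊 (toΩ s ∧Ω p)
      (∧-Classifier (proj₂ p) s (In𝕊⇒Classifier p ∘ s→p∈𝕊))

mainTheorem1 : (F : Foundations)
    → let open WithFoundations F in
      (S : OmegaCPO 0ℓ 0ℓ) (η : 𝔹 → OmegaCPO.Carrier S) → IsFreeOver𝔹 S η
    → let open Sierpinski S η in
      (p : Ω) (s : OmegaCPO.Carrier S)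
    → (proj₁ (toΩ s) → In𝕊 p)
    → In𝕊 (toΩ s ∧Ω p)
mainTheorem1 F = FreeSierpinski.dominance F
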